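{- The system $\mathbf{KB5}^\blacktriangle$ is sound and strongly complete with respect to the class of symmetric and Euclidean frames ($\mathcal{B}5$-frames); thus it is also sound and strongly complete with respect to the class of reflexive and Euclidean frames ($\mathcal{S}5$-frames).
   Context: Let $\mathbf{P}$ be a set of propositional variables. $\mathcal{L}(\blacktriangle)$-formulas: $\varphi::=\top\mid p\mid\neg\varphi\mid(\varphi\land\varphi)\mid\blacktriangle\varphi$ with $p\in\mathbf{P}$; other Boolean connectives are defined as usual. A frame is $\langle S,R\rangle$ with $S$ nonempty and $R\subseteq S\times S$; a model on it adds a valuation $V:\mathbf{P}\to\mathcal{P}(S)$. Euclidean: $sRt$ and $sRu$ imply $tRu$. Truth: $\top$, variables, $\neg$, $\land$ as usual; $\mathcal{M},s\vDash\blacktriangle\varphi$ iff (if $\mathcal{M},s\vDash\varphi$ then $\mathcal{M},t\vDash\varphi$ for all $t$ with $sRt$) and (if $\mathcal{M},s\nvDash\varphi$ then $\mathcal{M},t\nvDash\varphi$ for all $t$ with $sRt$). $\Gamma$ entails $\varphi$ over a class of frames if $\Gamma\cup\{\neg\varphi\}$ is not satisfied at any point of any model based on a frame in the class. The axiomatic system $\mathbf{K}^\blacktriangle$ consists of all propositional tautologies, uniform substitution, modus ponens, plus the axioms (with $p,q$ propositional variables) $\blacktriangle\top$; $\ \blacktriangle\neg p\leftrightarrow\blacktriangle p$; $\ \blacktriangle p\land\blacktriangle q\to\blacktriangle(p\land q)$; and the inference rule R: from $\varphi\to\psi$ infer $\blacktriangle\varphi\land\varphi\to\blacktriangle\psi$.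 $\mathbf{KB5}^\blacktriangle$ is $\mathbf{K}^\blacktriangle$ plus the two axioms $p\to\blacktriangle(\blacktriangle p\to p)$ and $\neg\blacktriangle p\to\blacktriangle\neg\blacktriangle p$. A derivation from $\Gamma$ to $\varphi$ in the system, notation $\Gamma\vdash\varphi$, is a finite sequence of $\mathcal{L}(\blacktriangle)$-formulas (ending in $\varphi$) in which each formula is either an instantiation of an axiom, or an element of $\Gamma$, or the result of applying an inference rule to prior formulas in the sequence. A theorem is a formula derivable from the empty set. Sound with respect to a class of frames: every theorem is valid on every frame of the class. Strongly complete with respect to a class: for all $\Gamma\cup\{\varphi\}\subseteq\mathcal{L}(\blacktriangle)$, if $\Gamma$ entails $\varphi$ over the class then $\Gamma\vdash\varphi$. -}

module Defs where

open import Data.Bool using (Bool; true; not) renaming (_∧_ to _and_)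
open import Data.List using (List; []; _∷_)
open import Data.List.Membership.Propositional using () renaming (_∈_ to _∈ˡ_)
open import Data.Nat using (ℕ)
open import Data.Product using (∃; _×_)
open import Data.Unit using () renaming (⊤ to Unit)
open import Level using (0ℓ; suc)
open import Relation.Binary using (Rel; Reflexive; Symmetric)
open import Relation.Binary.PropositionalEquality using (_≡_)
open import Relation.Nullary using (¬_)
open import Relation.Unary using (Pred; _∈_; _∪_; ∅; ｛_｝)

infixr 8 ∼_ ▲_
infixr 7 _∧_
infixr 6 _⇒_
infix  5 _⇔_

data Form (X : Set) : Set where
  top : Form X
  var : X → Form X
  ∼_  : Form X → Form X
  _∧_ : Form X → Form X → Form X
  ▲_  : Form X → Form X

_⇒_ : ∀ {X} → Form X → Form X → Form X
φ ⇒ ψ = ∼ (φ ∧ ∼ ψ)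

_⇔_ : ∀ {X} → Form X → Form X → Form X
φ ⇔ ψ = (φ ⇒ ψ) ∧ (ψ ⇒ φ)

_[_] : ∀ {X Y} → Form X → (X → Form Y) → Form Y
top     [ σ ] = top
var x   [ σ ] = σ x
(∼ φ)   [ σ ] = ∼ (φ [ σ ])
(φ ∧ ψ) [ σ ] = (φ [ σ ]) ∧ (ψ [ σ ])
(▲ φ)   [ σ ] = ▲ (φ [ σ ])

record Frame : Set₁ where
  field
    S        : Set
    R        : Rel S 0ℓ
    nonempty : S

record Model (P : Set) : Set₁ where
  field
    frame : Frame
  open Frame frame public
  field
    V : P → Pred S 0ℓ

FrameClass : Set₁
FrameClass = Pred Frame 0ℓ

Euclidean : ∀ {S : Set} → Rel S 0ℓ → Set
Euclidean R = ∀ {s t u} → R s t → R s u → R t u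

B5-frames : FrameClass
B5-frames F = Symmetric R × Euclidean R
  where open Frame F

S5-frames : FrameClass
S5-frames F = Reflexive R × Euclidean R
  where open Frame F

infix 4 _,_⊨_

_,_⊨_ : ∀ {P} (M : Model P) → Model.S M → Form P → Set
M , s ⊨ top   = Unit
M , s ⊨ var p = s ∈ Model.V M p
M , s ⊨ ∼ φ   = ¬ (M , s ⊨ φ)
M , s ⊨ φ ∧ ψ = (M , s ⊨ φ) × (M , s ⊨ ψ)
M , s ⊨ ▲ φ   = (M , s ⊨ φ → ∀ t → Model.R M s t → M , t ⊨ φ)
              × (¬ (M , s ⊨ φ) → ∀ t → Model.R M s t → ¬ (M , t ⊨ φ))

ValidOn : ∀ {P} → Frame → Form P → Set₁
ValidOn {P} F φ = ∀ (V : P → Pred (Frame.S F) 0ℓ) s →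
                  record { frame = F ; V = V } , s ⊨ φ

SatisfiableIn : ∀ {P} → FrameClass → Pred (Form P) 0ℓ → Set₁
SatisfiableIn {P} C Δ = ∃ λ (M : Model P) → Model.frame M ∈ C ×
                        ∃ λ s → ∀ φ → φ ∈ Δ → M , s ⊨ φ

Entails : ∀ {P} → FrameClass → Pred (Form P) 0ℓ → Form P → Set₁
Entails C Γ φ = ¬ SatisfiableIn C (Γ ∪ ｛ ∼ φ ｝)

-- Truth value under an assignment to the truth-functionally atomic formulas:
-- the values that v gives to top, negations and conjunctions are not consulted.
eval : ∀ {X} → (Form X → Bool) → Form X → Bool
eval v top     = true
eval v (var x) = v (var x)
eval v (∼ φ)   = not (eval v φ)
eval v (φ ∧ ψ) = eval v φ and eval v ψ
eval v (▲ φ)   = v (▲ φ)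

Tautology : ∀ {X} → Pred (Form X) 0ℓ
Tautology φ = ∀ v → eval v φ ≡ true

-- Axioms are written in the letters ℕ, not in the variables of the object
-- language, so that p and q below are distinct letters and tautologies have
-- as many letters as needed even when the object language has few variables.
-- Uniform substitution enters through the instances α [ σ ] in Justified.
private
  p q : Form ℕ
  p = var 0
  q = var 1

data K▲ : Pred (Form ℕ) 0ℓ where
  taut : ∀ {τ} → Tautology τ → K▲ τ
  ▲⊤   : K▲ (▲ top)
  ▲¬   : K▲ (▲ ∼ p ⇔ ▲ p)
  ▲∧   : K▲ (▲ p ∧ ▲ q ⇒ ▲ (p ∧ q))

data KB5▲ : Pred (Form ℕ) 0ℓ where
  k▲ : ∀ {α} → K▲ α → KB5▲ α
  ▲B : KB5▲ (p ⇒ ▲ (▲ p ⇒ p))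
  ▲5 : KB5▲ (∼ ▲ p ⇒ ▲ ∼ ▲ p)

-- Justified Ax Γ φs φ: φ may follow the formulas φs in a derivation from Γ.
data Justified {P} (Ax : Pred (Form ℕ) 0ℓ) (Γ : Pred (Form P) 0ℓ)
               (φs : List (Form P)) : Pred (Form P) 0ℓ where
  axiom   : ∀ {α} → α ∈ Ax → (σ : ℕ → Form P) → Justified Ax Γ φs (α [ σ ])
  premise : ∀ {φ} → φ ∈ Γ → Justified Ax Γ φs φ
  mp      : ∀ {φ ψ} → φ ∈ˡ φs → (φ ⇒ ψ) ∈ˡ φs → Justified Ax Γ φs ψ
  ruleR   : ∀ {φ ψ} → (φ ⇒ ψ) ∈ˡ φs → Justified Ax Γ φs (▲ φ ∧ φ ⇒ ▲ ψ)

-- The sequence is listed with its last formula first.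
data Derivation {P} (Ax : Pred (Form ℕ) 0ℓ) (Γ : Pred (Form P) 0ℓ) :
                Pred (List (Form P)) 0ℓ where
  []  : Derivation Ax Γ []
  _∷_ : ∀ {φ φs} → Justified Ax Γ φs φ → Derivation Ax Γ φs →
        Derivation Ax Γ (φ ∷ φs)

infix 4 _⊢[_]_

_⊢[_]_ : ∀ {P} → Pred (Form P) 0ℓ → Pred (Form ℕ) 0ℓ → Form P → Set
Γ ⊢[ Ax ] φ = ∃ λ φs → Derivation Ax Γ (φ ∷ φs)

Theorem : ∀ {P} → Pred (Form ℕ) 0ℓ → Form P → Set
Theorem Ax φ = ∅ ⊢[ Ax ] φ

Sound : Set → Pred (Form ℕ) 0ℓ → FrameClass → Set₁
Sound P Ax C = ∀ (φ : Form P) → Theorem Ax φ → ∀ F → F ∈ C → ValidOn F φ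

StronglyComplete : Set → Pred (Form ℕ) 0ℓ → FrameClass → Set₁
StronglyComplete P Ax C = ∀ (Γ : Pred (Form P) 0ℓ) (φ : Form P) →
                          Entails C Γ φ → Γ ⊢[ Ax ] φ

{-# OPTIONS --safe #-}

-- Write □φ for ▲φ ∧ φ. The system derives the normal modal laws for □ together
-- with T and 5, so the canonical model with s R t iff {φ : □φ ∈ s} ⊆ t is
-- reflexive and Euclidean, and ▲φ ∈ s iff □φ ∈ s or □∼φ ∈ s gives the truth
-- lemma. Every reflexive Euclidean frame is symmetric, so it suffices to prove
-- completeness for S5-frames and soundness for B5-frames.
module Submission where

open import Defs
open import Axiom.ExcludedMiddle using (ExcludedMiddle)
open import Axiom.Extensionality.Propositional using (Extensionality)
open import Data.Bool using (Bool; true; false; T) renaming (_∧_ to _&&_)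
open import Data.Bool.Properties using (T-∧; T-≡; ⇔→≡)
open import Data.Empty using (⊥-elim)
open import Data.List using ([]; _∷_; _++_)
open import Data.List.Membership.Propositional using () renaming (_∈_ to _∈ˡ_)
open import Data.List.Membership.Propositional.Properties using (∈-++⁺ˡ; ∈-++⁺ʳ)
open import Data.List.Relation.Unary.All as All using (All; []; _∷_)
open import Data.List.Relation.Unary.Any using (here; there)
open import Data.Nat using (ℕ; zero; suc)
open import Data.Product using (∃; _×_; _,_; proj₁; proj₂)
open import Data.Sum using (_⊎_; inj₁; inj₂; [_,_]′)
open import Data.Unit using (tt)
open import Function using (_∘_; id; Equivalence; mk⇔)
open import Level using (0ℓ)
open import Relation.Binary.PropositionalEquality
  using (_≡_; refl; trans; subst)
open import Relation.Nullary using (¬_; Dec; yes; no; does; proof; contradiction)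
open import Relation.Nullary.Decidable using (decidable-stable; dec-true)
open import Relation.Nullary.Reflects
  using (Reflects; ofʸ; invert; ¬-reflects; _×-reflects_)
open import Relation.Unary using (Pred; _∈_; _∉_; _⊆_; _∪_; ∅; ｛_｝; ⋃)

⟦_⟧ : {F : Set} → (F → Bool) → Pred F 0ℓ
⟦ A ⟧ x = A x ≡ true

-- Combining derivation sequences

justified-mono : ∀ {P Ax} {Γ Δ : Pred (Form P) 0ℓ} {φs ψs φ} → Γ ⊆ Δ →
                 (∀ {χ} → χ ∈ˡ φs → χ ∈ˡ ψs) →
                 Justified Ax Γ φs φ → Justified Ax Δ ψs φ
justified-mono sub inc (axiom a σ) = axiom a σ
justified-mono sub inc (premise h) = premise (sub h)
justified-mono sub inc (mp i j)    = mp (inc i) (inc j)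
justified-mono sub inc (ruleR i)   = ruleR (inc i)

derivation-mono : ∀ {P Ax} {Γ Δ : Pred (Form P) 0ℓ} {φs} → Γ ⊆ Δ →
                  Derivation Ax Γ φs → Derivation Ax Δ φs
derivation-mono sub []      = []
derivation-mono sub (j ∷ d) = justified-mono sub id j ∷ derivation-mono sub d

-- Sequences list their last formula first, so `ψs` runs before `φs`, and the steps of `φs` merely
-- gain earlier formulas to refer to.
derivation-++ : ∀ {P Ax} {Γ : Pred (Form P) 0ℓ} {φs ψs} →
                Derivation Ax Γ φs → Derivation Ax Γ ψs →
                Derivation Ax Γ (φs ++ ψs)
derivation-++ []      e = e
derivation-++ (j ∷ d) e = justified-mono id ∈-++⁺ˡ j ∷ derivation-++ d e

derive-mp : ∀ {P Ax} {Γ : Pred (Form P) 0ℓ} {φ ψ} →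
            Γ ⊢[ Ax ] φ → Γ ⊢[ Ax ] φ ⇒ ψ → Γ ⊢[ Ax ] ψ
derive-mp {φ = φ} (φs , d) (_ , e) =
  _ , mp (here refl) (∈-++⁺ʳ (φ ∷ φs) (here refl)) ∷ derivation-++ d e

derive-R : ∀ {P Ax} {Γ : Pred (Form P) 0ℓ} {φ ψ} →
           Γ ⊢[ Ax ] φ ⇒ ψ → Γ ⊢[ Ax ] ▲ φ ∧ φ ⇒ ▲ ψ
derive-R (_ , d) = _ , ruleR (here refl) ∷ d

derive-axiom : ∀ {P Ax} {Γ : Pred (Form P) 0ℓ} {α} → α ∈ Ax →
               (σ : ℕ → Form P) → Γ ⊢[ Ax ] α [ σ ]
derive-axiom a σ = _ , axiom a σ ∷ []

-- Propositional reasoning by truth tables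

letters : ∀ {A : Set} → A → A → A → ℕ → A
letters a b c zero          = a
letters a b c (suc zero)    = b
letters a b c (suc (suc _)) = c

assign : Bool → Bool → Bool → Form ℕ → Bool
assign a b c (var n) = letters a b c n
assign a b c _       = true

every : (Bool → Bool) → Bool
every f = f true && f false

every-elim : ∀ f → T (every f) → ∀ b → T (f b)
every-elim f h true  = proj₁ (Equivalence.to (T-∧ {f true}) h)
every-elim f h false = proj₂ (Equivalence.to (T-∧ {f true}) h)

truth-table : Form ℕ → Bool
truth-table α = every λ a → every λ b → every λ c → eval (assign a b c) α

truth-table-sound : ∀ α → T (truth-table α) → ∀ a b c → T (eval (assign a b c) α)
truth-table-sound α h a b = every-elim (λ c → eval (assign a b c) α)
  (every-elim (λ b → every λ c → eval (assign a b c) α)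
    (every-elim (λ a → every λ b → every λ c → eval (assign a b c) α) h a) b)

-- For a concrete α in the letters 0, 1, 2 without ▲, both the locality
-- hypothesis and the truth table hold by computation.
tautology : ∀ {P} α →
            (∀ v → eval v α ≡
                   eval (assign (v (var 0)) (v (var 1)) (v (var 2))) α) →
            {T (truth-table α)} → ∀ (φ ψ χ : Form P) →
            Theorem KB5▲ (α [ letters φ ψ χ ])
tautology α local {t} φ ψ χ =
  derive-axiom {α = α} (k▲ (taut λ v → trans (local v)
    (Equivalence.to T-≡ (truth-table-sound α t _ _ _)))) (letters φ ψ χ)

private
  a b c : Form ℕ
  a = var 0
  b = var 1
  c = var 2

-- Here rule R is confined to theorems, unlike in _⊢[_]_: this restriction is
-- what makes the deduction theorem hold.
infix 4 _⊢_
data _⊢_ {P} (Γ : Pred (Form P) 0ℓ) : Pred (Form P) 0ℓ where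
  thm    : ∀ {φ} → Theorem KB5▲ φ → Γ ⊢ φ
  hyp    : ∀ {φ} → φ ∈ Γ → Γ ⊢ φ
  detach : ∀ {φ ψ} → Γ ⊢ φ → Γ ⊢ φ ⇒ ψ → Γ ⊢ ψ

-- Deduction theorem and compactness for the restricted consequence

module _ {P : Set} where

  private variable
    Γ Δ : Pred (Form P) 0ℓ
    φ ψ : Form P

  -- Lets completeness be proved for `_⊢_` and then transferred to the official notion of
  -- derivation.
  ⊢⇒⊢[] : Γ ⊢ φ → Γ ⊢[ KB5▲ ] φ
  ⊢⇒⊢[] (thm (_ , d))  = _ , derivation-mono (λ ()) d
  ⊢⇒⊢[] (hyp h)        = _ , premise h ∷ []
  ⊢⇒⊢[] (detach d e)   = derive-mp (⊢⇒⊢[] d) (⊢⇒⊢[] e)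

  ⊢-mono : Γ ⊆ Δ → Γ ⊢ φ → Δ ⊢ φ
  ⊢-mono sub (thm t)      = thm t
  ⊢-mono sub (hyp h)      = hyp (sub h)
  ⊢-mono sub (detach d e) = detach (⊢-mono sub d) (⊢-mono sub e)

  deduction : (Γ ∪ ｛ φ ｝) ⊢ ψ → Γ ⊢ φ ⇒ ψ
  deduction (thm t) = detach (thm t)
    (thm (tautology (a ⇒ b ⇒ a) (λ _ → refl) _ _ top))
  deduction (hyp (inj₁ h)) = detach (hyp h)
    (thm (tautology (a ⇒ b ⇒ a) (λ _ → refl) _ _ top))
  deduction (hyp (inj₂ refl)) =
    thm (tautology (a ⇒ a) (λ _ → refl) _ top top)
  deduction (detach d e) = detach (deduction d) (detach (deduction e)
    (thm (tautology ((a ⇒ b ⇒ c) ⇒ (a ⇒ b) ⇒ a ⇒ c) (λ _ → refl) _ _ _)))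

  -- Compactness: at each detachment, the larger of two members of the chain serves both premises.
  -- The left alternative covers proofs from `Γ` alone, the only ones when `I` is empty.
  ⊢-⋃-chain : {I : Set} (A : I → Pred (Form P) 0ℓ) →
              (∀ i j → A i ⊆ A j ⊎ A j ⊆ A i) →
              (Γ ∪ ⋃ I A) ⊢ φ → Γ ⊢ φ ⊎ ∃ λ i → (Γ ∪ A i) ⊢ φ
  ⊢-⋃-chain A chain (thm t)              = inj₁ (thm t)
  ⊢-⋃-chain A chain (hyp (inj₁ h))       = inj₁ (hyp h)
  ⊢-⋃-chain A chain (hyp (inj₂ (i , h))) = inj₂ (i , hyp (inj₂ h))
  ⊢-⋃-chain A chain (detach d e)
    with ⊢-⋃-chain A chain d | ⊢-⋃-chain A chain e
  ... | inj₁ d′       | inj₁ e′       = inj₁ (detach d′ e′)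
  ... | inj₁ d′       | inj₂ (i , e′) = inj₂ (i , detach (⊢-mono inj₁ d′) e′)
  ... | inj₂ (i , d′) | inj₁ e′       = inj₂ (i , detach d′ (⊢-mono inj₁ e′))
  ... | inj₂ (i , d′) | inj₂ (j , e′) with chain i j
  ...   | inj₁ i⊆j = inj₂ (j , detach (⊢-mono [ inj₁ , inj₂ ∘ i⊆j ]′ d′) e′)
  ...   | inj₂ j⊆i = inj₂ (i , detach d′ (⊢-mono [ inj₁ , inj₂ ∘ j⊆i ]′ e′))

-- Worlds and the normal modal laws of □

record World (P : Set) : Set where
  field
    -- Boolean-valued because the points of a frame form a `Set`, whereas `Pred (Form P) 0ℓ` lies in
    -- `Set₁`.
    member     : Form P → Bool
    deductive  : ∀ {φ} → ⟦ member ⟧ ⊢ φ → φ ∈ ⟦ member ⟧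
    consistent : ∀ {φ} → ∼ φ ∈ ⟦ member ⟧ → φ ∉ ⟦ member ⟧
    complete   : ∀ {φ} → φ ∉ ⟦ member ⟧ → ∼ φ ∈ ⟦ member ⟧

  apply : ∀ {φ ψ} → Theorem KB5▲ (φ ⇒ ψ) → φ ∈ ⟦ member ⟧ → ψ ∈ ⟦ member ⟧
  apply t h = deductive (detach (hyp h) (thm t))

  ∧-intro : ∀ {φ ψ} → φ ∈ ⟦ member ⟧ → ψ ∈ ⟦ member ⟧ → φ ∧ ψ ∈ ⟦ member ⟧
  ∧-intro h k = deductive (detach (hyp k) (detach (hyp h)
    (thm (tautology (a ⇒ b ⇒ a ∧ b) (λ _ → refl) _ _ top))))

  ∧-elimˡ : ∀ {φ ψ} → φ ∧ ψ ∈ ⟦ member ⟧ → φ ∈ ⟦ member ⟧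
  ∧-elimˡ = apply (tautology (a ∧ b ⇒ a) (λ _ → refl) _ _ top)

  ∧-elimʳ : ∀ {φ ψ} → φ ∧ ψ ∈ ⟦ member ⟧ → ψ ∈ ⟦ member ⟧
  ∧-elimʳ = apply (tautology (a ∧ b ⇒ b) (λ _ → refl) _ _ top)

  Box : Pred (Form _) 0ℓ
  Box φ = ▲ φ ∈ ⟦ member ⟧ × φ ∈ ⟦ member ⟧

  ▲-∼ : ∀ {φ} → ▲ φ ∈ ⟦ member ⟧ → ▲ ∼ φ ∈ ⟦ member ⟧
  ▲-∼ {φ} h = deductive (detach (hyp h) (detach
    (thm (derive-axiom (k▲ ▲¬) (letters φ top top)))
    (thm (tautology (a ∧ b ⇒ b) (λ _ → refl) _ _ top))))

  ▲-∼⁻ : ∀ {φ} → ▲ ∼ φ ∈ ⟦ member ⟧ → ▲ φ ∈ ⟦ member ⟧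
  ▲-∼⁻ {φ} h = deductive (detach (hyp h) (detach
    (thm (derive-axiom (k▲ ▲¬) (letters φ top top)))
    (thm (tautology (a ∧ b ⇒ a) (λ _ → refl) _ _ top))))

  -- Rule R is exactly what moves the ▲-half of □ along a provable implication.
  Box-mono : ∀ {φ ψ} → Theorem KB5▲ (φ ⇒ ψ) → Box φ → Box ψ
  Box-mono t (▲φ , h) = apply (derive-R t) (∧-intro ▲φ h) , apply t h

  Box-∧ : ∀ {φ ψ} → Box φ → Box ψ → Box (φ ∧ ψ)
  Box-∧ {φ} {ψ} (▲φ , h) (▲ψ , k) =
    apply (derive-axiom (k▲ ▲∧) (letters φ ψ top)) (∧-intro ▲φ ▲ψ) , ∧-intro h k

  -- Normality of □. Detachment under □ combines `Box-∧` with monotonicity; a theorem is necessary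
  -- because it is implied by `top`, which is necessary.
  Box-deductive : ∀ {φ} → Box ⊢ φ → Box φ
  Box-deductive (hyp h) = h
  Box-deductive (detach d e) =
    Box-mono (tautology (a ∧ (a ⇒ b) ⇒ b) (λ _ → refl) _ _ top)
             (Box-∧ (Box-deductive d) (Box-deductive e))
  Box-deductive (thm t) =
    Box-mono (derive-mp t (tautology (a ⇒ top ⇒ a) (λ _ → refl) _ top top))
      ( deductive (thm (derive-axiom (k▲ ▲⊤) (letters top top top)))
      , deductive (thm (tautology top (λ _ → refl) top top top)) )

-- Canonical model

canonical-R : ∀ {P} → World P → World P → Set
canonical-R s t = World.Box s ⊆ ⟦ World.member t ⟧

canonical : ∀ {P} → World P → Model P
canonical s = record
  { frame = record { S = World _ ; R = canonical-R ; nonempty = s }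
  ; V     = λ p w → var p ∈ ⟦ World.member w ⟧
  }

module Classical (em : ∀ {ℓ} → ExcludedMiddle ℓ)
                 (ext : ∀ {a b} → Extensionality a b) where

  dne : ∀ {ℓ} {A : Set ℓ} → ¬ ¬ A → A
  dne = decidable-stable em

  char : ∀ {ℓ} {F : Set} → Pred F ℓ → F → Bool
  char A x = does (em {P = A x})

  module _ {ℓ} {F : Set} (A : Pred F ℓ) where

    char⁺ : A ⊆ ⟦ char A ⟧
    char⁺ = dec-true em

    char⁻ : ⟦ char A ⟧ ⊆ A
    char⁻ {x} h = invert (subst (Reflects (A x)) h (proof em))

  -- Zorn's lemma for sets. Excluded middle applies to arbitrary types, so it
  -- also picks witnesses and thus supplies the choice function in next. Subsets
  -- are Boolean-valued to keep the impredicative Tower small.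
  module Maximal {F : Set} (Con : Pred (Pred F 0ℓ) 0ℓ)
    (antitone : ∀ {A B} → A ⊆ B → Con B → Con A)
    (chain-closed : ∀ {I : Set} (A : I → Pred F 0ℓ) →
                    (∀ i j → A i ⊆ A j ⊎ A j ⊆ A i) →
                    (∀ i → Con (A i)) → Con (⋃ I A)) where

    private variable
      A B : F → Bool

    infix 4 _≼_
    _≼_ : (A B : F → Bool) → Set
    A ≼ B = ⟦ A ⟧ ⊆ ⟦ B ⟧

    ≼-antisym : A ≼ B → B ≼ A → A ≡ B
    ≼-antisym A≼B B≼A = ext λ x → ⇔→≡ (mk⇔ A≼B B≼A)

    Extendable : Pred (F → Bool) 0ℓ
    Extendable A = ∃ λ x → x ∉ ⟦ A ⟧ × Con (⟦ A ⟧ ∪ ｛ x ｝)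

    -- The decision is an argument so that the lemmas below can split on it; `next` supplies `em`.
    extend : (A : F → Bool) → Dec (Extendable A) → F → Bool
    extend A (yes (x , _)) = char (⟦ A ⟧ ∪ ｛ x ｝)
    extend A (no _)        = A

    next : (F → Bool) → F → Bool
    next A = extend A em

    extend-⊇ : (d : Dec (Extendable A)) → A ≼ extend A d
    extend-⊇ {A} (yes (x , _)) = char⁺ (⟦ A ⟧ ∪ ｛ x ｝) ∘ inj₁
    extend-⊇ (no _)            = id

    extend-Con : (d : Dec (Extendable A)) → Con ⟦ A ⟧ → Con ⟦ extend A d ⟧
    extend-Con {A} (yes (x , _ , con)) _ = antitone (char⁻ (⟦ A ⟧ ∪ ｛ x ｝)) con
    extend-Con (no _) con                = con

    extend-fixed : (d : Dec (Extendable A)) → extend A d ≼ A → ¬ Extendable A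
    extend-fixed {A} (yes (x , x∉A , _)) fix _ =
      x∉A (fix (char⁺ (⟦ A ⟧ ∪ ｛ x ｝) (inj₂ refl)))
    extend-fixed (no ¬e) _ e = ¬e e

    Union : ((F → Bool) → Bool) → Pred F 0ℓ
    Union D = ⋃ (∃ ⟦ D ⟧) (⟦_⟧ ∘ proj₁)

    lub : ((F → Bool) → Bool) → F → Bool
    lub D = char (Union D)

    -- The stages of the transfinite iteration of `next`, generated without ordinals; the union of
    -- the empty family is the starting stage.
    data Tower : Pred (F → Bool) 0ℓ where
      step  : Tower A → Tower (next A)
      limit : (D : (F → Bool) → Bool) → ⟦ D ⟧ ⊆ Tower → Tower (lub D)

    -- Stronger than linearity: it also excludes stages strictly between `B` and `next B`, which
    -- carries the induction through successors.
    Comparable : (A B : F → Bool) → Set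
    Comparable A B = A ≼ B ⊎ next B ≼ A

    comparable-next : Comparable A B → Comparable B A → Comparable (next A) B
    comparable-next _ (inj₂ nA≼B) = inj₁ nA≼B
    comparable-next (inj₂ nB≼A) (inj₁ _) = inj₂ λ h → extend-⊇ em (nB≼A h)
    -- The two sets have the same elements. Extensionality makes them identical, so the choice
    -- inside `next` agrees on them.
    comparable-next {B = B} (inj₁ A≼B) (inj₁ B≼A) =
      inj₂ λ {x} → subst (λ C → next B x ≡ true → next C x ≡ true)
                         (≼-antisym B≼A A≼B) id

    comparable-lub : ∀ D → (∀ {C} → C ∈ ⟦ D ⟧ → Comparable C B) →
                     Comparable (lub D) B
    comparable-lub {B} D cmp
      with em {P = ∃ λ C → C ∈ ⟦ D ⟧ × next B ≼ C}
    ... | yes (C , C∈D , nB≼C) = inj₂ λ h → char⁺ (Union D) ((C , C∈D) , nB≼C h)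
    ... | no  none             = inj₁ λ h → below (char⁻ (Union D) h)
      where
      below : Union D ⊆ ⟦ B ⟧
      below ((C , C∈D) , x∈C) with cmp C∈D
      ... | inj₁ C≼B  = C≼B x∈C
      ... | inj₂ nB≼C = ⊥-elim (none (C , C∈D , nB≼C))

    -- `Comparable` is not symmetric, so the successor case of `comparable` needs this mirror image,
    -- by an inner induction on `B`.
    comparable-flip : (∀ {C} → Tower C → Comparable A C) →
                      Tower B → Comparable B A
    comparable-flip cmp (step t)    =
      comparable-next (comparable-flip cmp t) (cmp t)
    comparable-flip cmp (limit D t) =
      comparable-lub D (comparable-flip cmp ∘ t)

    comparable : Tower A → Tower B → Comparable A B
    comparable (step t)    u =
      comparable-next (comparable t u) (comparable-flip (comparable t) u)
    comparable (limit D t) u = comparable-lub D λ C∈D → comparable (t C∈D) u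

    linear : Tower A → Tower B → A ≼ B ⊎ B ≼ A
    linear t u with comparable t u
    ... | inj₁ A≼B  = inj₁ A≼B
    ... | inj₂ nB≼A = inj₂ λ h → nB≼A (extend-⊇ em h)

    tower-Con : Tower A → Con ⟦ A ⟧
    tower-Con (step t)    = extend-Con em (tower-Con t)
    tower-Con (limit D t) = antitone (char⁻ (Union D))
      (chain-closed (⟦_⟧ ∘ proj₁) (λ (_ , i) (_ , j) → linear (t i) (t j))
                    (λ (_ , i) → tower-Con (t i)))

    summit : F → Bool
    summit = lub (char Tower)

    summit-tower : Tower summit
    summit-tower = limit (char Tower) (char⁻ Tower)

    -- The union of all stages is itself a stage, so it contains its own successor and admits no
    -- proper extension.
    maximal : ∃ λ (M : F → Bool) → Con ⟦ M ⟧ ×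
              ∀ x → Con (⟦ M ⟧ ∪ ｛ x ｝) → x ∈ ⟦ M ⟧
    maximal = summit , tower-Con summit-tower , λ x con → dne λ x∉M →
      extend-fixed em
        (λ h → char⁺ (Union (char Tower)) ((_ , char⁺ Tower (step summit-tower)) , h))
                   (x , x∉M , con)

  -- Lindenbaum's lemma

  lindenbaum : ∀ {P} {Γ : Pred (Form P) 0ℓ} → ¬ (Γ ⊢ ∼ top) →
               ∃ λ (w : World P) → Γ ⊆ ⟦ World.member w ⟧
  lindenbaum {P} {Γ} Γ⊬⊥
    with M , con , max ← Maximal.maximal
           -- Consistency is taken jointly with `Γ`, so that maximality pulls `Γ` and its
           -- consequences into `M`.
           (λ A → ¬ ((Γ ∪ A) ⊢ ∼ top))
           (λ sub B⊬ → B⊬ ∘ ⊢-mono [ inj₁ , inj₂ ∘ sub ]′)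
           (λ A chain A⊬ d →
              [ Γ⊬⊥ , (λ (i , d′) → A⊬ i d′) ]′ (⊢-⋃-chain A chain d))
    = record
      { member     = M
      ; deductive  = λ d → closed (⊢-mono inj₂ d)
      ; consistent = λ ∼φ∈M φ∈M → con (detach (hyp (inj₂ φ∈M))
          (detach (hyp (inj₂ ∼φ∈M))
            (thm (tautology (∼ a ⇒ a ⇒ ∼ top) (λ _ → refl) _ top top))))
      ; complete   = λ φ∉M → closed (detach
          (deduction (dne λ ⊬ → φ∉M (max _ (⊬ ∘ ⊢-mono (assoc _)))))
          (thm (tautology ((a ⇒ ∼ top) ⇒ ∼ a) (λ _ → refl) _ top top)))
      } , λ h → closed (hyp (inj₁ h))
    where
    assoc : ∀ φ → Γ ∪ (⟦ M ⟧ ∪ ｛ φ ｝) ⊆ (Γ ∪ ⟦ M ⟧) ∪ ｛ φ ｝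
    assoc _ (inj₁ x)        = inj₁ (inj₁ x)
    assoc _ (inj₂ (inj₁ x)) = inj₁ (inj₂ x)
    assoc _ (inj₂ (inj₂ x)) = inj₂ x

    -- By the deduction theorem, a contradiction from adding a consequence would already be
    -- derivable without it.
    closed : ∀ {φ} → (Γ ∪ ⟦ M ⟧) ⊢ φ → φ ∈ ⟦ M ⟧
    closed d = max _ λ e → con (detach d (deduction (⊢-mono (assoc _) e)))

  unprovable⇒consistent : ∀ {P} {Γ : Pred (Form P) 0ℓ} {φ} →
                          ¬ (Γ ⊢ φ) → ¬ ((Γ ∪ ｛ ∼ φ ｝) ⊢ ∼ top)
  unprovable⇒consistent ⊬φ d = ⊬φ (detach (deduction d)
    (thm (tautology ((∼ a ⇒ ∼ top) ⇒ a) (λ _ → refl) _ top top)))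

  -- Canonical frame and existence lemma

  canonical-refl : ∀ {P} (s : World P) → canonical-R s s
  canonical-refl s = proj₂

  -- A box at `t` must already hold at `s`, hence reach `u`. Otherwise `s` boxes either `∼ φ` or, by
  -- axiom `▲5`, `∼ ▲ φ`, and passes to `t` the negation of a member of `t`.
  canonical-eucl : ∀ {P} {s t u : World P} →
                   canonical-R s t → canonical-R s u → canonical-R t u
  canonical-eucl {s = s} {t} st su {φ} (▲φ∈t , φ∈t)
    with em {P = ▲ φ ∈ ⟦ World.member s ⟧} | em {P = φ ∈ ⟦ World.member s ⟧}
  ... | yes ▲φ | yes h  = su (▲φ , h)
  ... | yes ▲φ | no ¬h  = contradiction φ∈t
    (World.consistent t (st (World.▲-∼ s ▲φ , World.complete s ¬h)))
  ... | no ¬▲φ | _      = contradiction ▲φ∈t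
    (World.consistent t (st (World.apply s
        (derive-axiom ▲5 (letters φ top top)) ∼▲φ , ∼▲φ)))
    where ∼▲φ = World.complete s ¬▲φ

  -- By normality the boxed formulas of `s` do not prove `φ`, so together with `∼ φ` they extend to
  -- a world.
  existence : ∀ {P} (s : World P) {φ} → φ ∉ World.Box s →
              ∃ λ t → canonical-R s t × φ ∉ ⟦ World.member t ⟧
  existence s ¬□φ =
    let t , sub = lindenbaum (unprovable⇒consistent (¬□φ ∘ World.Box-deductive s))
    in t , sub ∘ inj₁ , World.consistent t (sub (inj₂ refl))

  -- Truth lemma

  module _ {P : Set} (s₀ : World P) where

    private M = canonical s₀

    -- The two directions are mutually recursive because negation exchanges them.
    truth⁺ : ∀ φ s → φ ∈ ⟦ World.member s ⟧ → M , s ⊨ φ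
    truth⁻ : ∀ φ s → M , s ⊨ φ → φ ∈ ⟦ World.member s ⟧

    truth⁺ top     s h = tt
    truth⁺ (var x) s h = h
    truth⁺ (∼ φ)   s h = World.consistent s h ∘ truth⁻ φ s
    truth⁺ (φ ∧ ψ) s h =
      truth⁺ φ s (World.∧-elimˡ s h) , truth⁺ ψ s (World.∧-elimʳ s h)
    truth⁺ (▲ φ)   s h =
      (λ ⊨φ t st → truth⁺ φ t (st (h , truth⁻ φ s ⊨φ))) ,
      (λ ⊭φ t st → World.consistent t
        (st (World.▲-∼ s h , World.complete s (⊭φ ∘ truth⁺ φ s))) ∘ truth⁻ φ t)

    truth⁻ top     s h = World.deductive s
      (thm (tautology top (λ _ → refl) top top top))
    truth⁻ (var x) s h = h
    truth⁻ (∼ φ)   s h = World.complete s (h ∘ truth⁺ φ s)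
    truth⁻ (φ ∧ ψ) s (h , k) = World.∧-intro s (truth⁻ φ s h) (truth⁻ ψ s k)
    -- If `▲ φ` is missing, neither `φ` nor `∼ φ` is boxed. For whichever of them lies in `s`, the
    -- existence lemma gives a successor violating `pos` or `neg`.
    truth⁻ (▲ φ)   s (pos , neg) with em {P = φ ∈ ⟦ World.member s ⟧}
    ... | yes h = dne λ ¬▲φ →
      let t , st , φ∉t = existence s (¬▲φ ∘ proj₁)
      in φ∉t (truth⁻ φ t (pos (truth⁺ φ s h) t st))
    ... | no ¬h = dne λ ¬▲φ →
      let t , st , ∼φ∉t = existence s (¬▲φ ∘ World.▲-∼⁻ s ∘ proj₁)
      in ∼φ∉t (World.complete t (neg (¬h ∘ truth⁻ φ s) t st ∘ truth⁺ φ t))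

  -- Strong completeness

  complete-S5 : ∀ P → StronglyComplete P KB5▲ S5-frames
  complete-S5 P Γ φ entails = ⊢⇒⊢[] (dne λ Γ⊬φ →
    let w , sub = lindenbaum (unprovable⇒consistent Γ⊬φ)
    in entails ( canonical w
               , ( (λ {s} → canonical-refl s)
                 , (λ {s} {t} {u} → canonical-eucl {s = s} {t} {u}) )
               , w , λ ψ h → truth⁺ w ψ w (sub h) ))

  S5⊆B5 : S5-frames ⊆ B5-frames
  S5⊆B5 (rfl , eucl) = (λ st → eucl st rfl) , eucl

  complete-B5 : ∀ P → StronglyComplete P KB5▲ B5-frames
  complete-B5 P Γ φ entails = complete-S5 P Γ φ
    λ (M , M∈S5 , sat) → entails (M , S5⊆B5 {Model.frame M} M∈S5 , sat)

  -- Soundness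

  module _ {P : Set} (M : Model P) (s : Model.S M) where

    ⇒⁺ : ∀ φ ψ → (M , s ⊨ φ → M , s ⊨ ψ) → M , s ⊨ φ ⇒ ψ
    ⇒⁺ _ _ f (h , ¬k) = ¬k (f h)

    ⇒⁻ : ∀ φ ψ → M , s ⊨ φ ⇒ ψ → M , s ⊨ φ → M , s ⊨ ψ
    ⇒⁻ _ _ i h = dne λ ¬k → i (h , ¬k)

    -- Truth at a point is a Boolean assignment to variables and ▲-formulas, so tautologies hold
    -- there under every substitution.
    eval-reflects : ∀ (σ : ℕ → Form P) α →
      Reflects (M , s ⊨ α [ σ ]) (eval (λ β → does (em {P = M , s ⊨ β [ σ ]})) α)
    eval-reflects σ top     = ofʸ tt
    eval-reflects σ (var x) = proof em
    eval-reflects σ (∼ α)   = ¬-reflects (eval-reflects σ α)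
    eval-reflects σ (α ∧ β) = eval-reflects σ α ×-reflects eval-reflects σ β
    eval-reflects σ (▲ α)   = proof em

    K▲-true : ∀ {α} → α ∈ K▲ → ∀ σ → M , s ⊨ α [ σ ]
    K▲-true (taut {τ} t) σ =
      invert (subst (Reflects _) (t _) (eval-reflects σ τ))
    K▲-true ▲⊤ σ = (λ _ _ _ → tt) , (λ ¬tt → ⊥-elim (¬tt tt))
    K▲-true ▲¬ σ =
      ⇒⁺ (▲ ∼ σ 0) (▲ σ 0)
        (λ (pos , neg) → (λ h t st → dne (neg (λ ¬h → ¬h h) t st)) , pos) ,
      ⇒⁺ (▲ σ 0) (▲ ∼ σ 0)
        (λ (pos , neg) → neg , (λ ¬¬h t st ¬k → ¬k (pos (dne ¬¬h) t st)))
    K▲-true ▲∧ σ = ⇒⁺ (▲ σ 0 ∧ ▲ σ 1) (▲ (σ 0 ∧ σ 1))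
      λ ((pos , neg) , (pos′ , neg′)) →
        (λ (h , h′) t st → pos h t st , pos′ h′ t st) ,
        (λ ¬hh′ t st (k , k′) → neg
          (λ h → neg′ (λ h′ → ¬hh′ (h , h′)) t st k′) t st k)

    KB5▲-true : Model.frame M ∈ B5-frames →
                ∀ {α} → α ∈ KB5▲ → ∀ σ → M , s ⊨ α [ σ ]
    KB5▲-true _ (k▲ α) σ = K▲-true α σ
    -- If a successor had `▲ p` without `p`, falsity of `p` would spread back to `s` by symmetry.
    KB5▲-true (symm , _) ▲B σ = ⇒⁺ (σ 0) (▲ (▲ σ 0 ⇒ σ 0)) λ h →
      (λ _ t st ((_ , neg) , ¬k) → neg ¬k s (symm st) h) ,
      (λ ¬i → ⊥-elim (¬i λ (_ , ¬h) → ¬h h))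
    -- A successor `t` sees `s` and all successors of `s`, so `▲ p` at `t` would fix the value of
    -- `p` on all of them and give `▲ p` at `s`.
    KB5▲-true (symm , eucl) ▲5 σ = ⇒⁺ (∼ ▲ σ 0) (▲ ∼ ▲ σ 0) λ ¬▲ →
      (λ _ t st (pos , neg) → ¬▲
        ( (λ h u su → pos (dne λ ¬k → neg ¬k s (symm st) h) u (eucl st su))
        , (λ ¬h u su → neg (λ k → ¬h (pos k s (symm st))) u (eucl st su)) )) ,
      (λ ¬¬▲ → ⊥-elim (¬¬▲ ¬▲))

  module _ {P : Set} {F : Frame} (F∈B5 : F ∈ B5-frames) where

    justified-valid : ∀ {φs} {φ : Form P} → Justified KB5▲ ∅ φs φ →
                      All (ValidOn F) φs → ValidOn F φ
    justified-valid (axiom α σ) _ V s = KB5▲-true _ s F∈B5 α σ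
    justified-valid (mp {φ} {ψ} i j) ih V s =
      ⇒⁻ _ s φ ψ (All.lookup ih j V s) (All.lookup ih i V s)
    -- The premise is valid on the frame, hence usable at every successor; `ψ` also holds at `s`
    -- itself, which makes the second clause vacuous.
    justified-valid (ruleR {φ} {ψ} i) ih V s = ⇒⁺ M s (▲ φ ∧ φ) (▲ ψ)
      λ ((pos , _) , h) →
        (λ _ t st → φ⇒ψ t (pos h t st)) , (λ ¬k → ⊥-elim (¬k (φ⇒ψ s h)))
      where
      M : Model P
      M = record { frame = F ; V = V }
      φ⇒ψ : ∀ t → M , t ⊨ φ → M , t ⊨ ψ
      φ⇒ψ t = ⇒⁻ M t φ ψ (All.lookup ih i V t)

    derivation-valid : ∀ {φs} → Derivation {P} KB5▲ ∅ φs → All (ValidOn F) φs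
    derivation-valid []      = []
    derivation-valid (j ∷ d) = justified-valid j ih ∷ ih
      where ih = derivation-valid d

  sound-B5 : ∀ P → Sound P KB5▲ B5-frames
  sound-B5 P φ (_ , d) F F∈B5 = All.head (derivation-valid F∈B5 d)

  sound-S5 : ∀ P → Sound P KB5▲ S5-frames
  sound-S5 P φ ⊢φ F F∈S5 = sound-B5 P φ ⊢φ F (S5⊆B5 {F} F∈S5)

theorem58 : (∀ {ℓ} → ExcludedMiddle ℓ) →
    (∀ {a b} → Extensionality a b) →
    (P : Set) →
    (Sound P KB5▲ B5-frames × StronglyComplete P KB5▲ B5-frames) ×
    (Sound P KB5▲ S5-frames × StronglyComplete P KB5▲ S5-frames)
theorem58 em ext P =
  (sound-B5 P , complete-B5 P) , (sound-S5 P , complete-S5 P)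
  where open Classical em ext
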